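{- Let $m$ and $n$ be nonnegative integers with the same parity, and let $l$ be a nonnegative integer. Let $A$ and $B$ be $m \times m$ and $n \times n$ skew-symmetric matrices, and let $S$ and $T$ be $m \times l$ and $n \times l$ matrices. Then $$ \sum_K \operatorname{Pf} \begin{pmatrix} A & S([m];K) \\ -{}^t S([m];K) & O \end{pmatrix} \operatorname{Pf} \begin{pmatrix} B & T([n];K) \\ -{}^t T([n];K) & O \end{pmatrix} = (-1)^{ \binom{n}{2} } \operatorname{Pf} \begin{pmatrix} A & S\, {}^t T \\ - T\, {}^t S & -B \end{pmatrix}, $$ where $K$ runs over all subsets of $[l]$ with $\# K \equiv m \equiv n \bmod 2$.
   Context: All matrices have entries in a fixed commutative ring; skew-symmetric means ${}^tX=-X$ with zero diagonal, where ${}^tX$ is the transpose. For a skew-symmetric matrix $X=(x_{ij})_{1\le i,j\le 2r}$ of even order, the Pfaffian is $$\operatorname{Pf}(X)=\sum_{\sigma\in F_{2r}}\operatorname{sgn}(\sigma)\prod_{i=1}^r x_{\sigma(2i-1),\sigma(2i)},$$ where $F_{2r}$ is the set of permutations $\sigma\in S_{2r}$ with $\sigma(1)<\sigma(3)<\dots<\sigma(2r-1)$ and $\sigma(2i-1)<\sigma(2i)$ for $1\le i\le r$. The Pfaffian of the empty ($0\times 0$) matrix is $1$. We write $[n]=\{1,2,\dots,n\}$. For an $M\times N$ matrix $X$ and subsets $I\subset[M]$, $J\subset[N]$, $X(I;J)$ denotes the submatrix of $X$ with rows indexed by $I$ and columns indexed by $J$ (in increasing order). $O$ denotes a zero matrix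 of the appropriate size, and $\#K$ is the cardinality of $K$. -}

module Defs where

open import Algebra.Bundles using (CommutativeRing; Semiring)
open import Data.Fin using (Fin; zero; suc; _<_; _<?_)
open import Data.Fin.Permutation using (Permutation′; _⟨$⟩ʳ_; id; insert)
open import Data.Fin.Properties using (all?)
open import Data.Fin.Subset using (Subset; inside; outside; ∣_∣)
open import Data.List using (List; []; _∷_; _++_; allFin; cartesianProduct; concatMap; filter; foldr; length; map)
open import Data.Nat using (ℕ; zero; suc; _+_; ⌊_/2⌋; parity)
open import Data.Parity.Properties using () renaming (_≟_ to _≟ₚ_)
open import Data.Product using (_×_; _,_)
open import Data.Vec using ([]; _∷_)
open import Data.Vec.Functional as Vector using (Vector)
open import Relation.Nullary using (Dec)
open import Relation.Nullary.Decidable using (_×-dec_; _→-dec_)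

-- Every permutation of Fin (suc n) is, up to pointwise equality, of the form
-- insert zero j π for exactly one j (the image of zero) and one π, so each
-- element of the symmetric group is listed exactly once.
permutations : ∀ n → List (Permutation′ n)
permutations zero    = id ∷ []
permutations (suc n) = concatMap (λ j → map (insert zero j) (permutations n)) (allFin (suc n))

inversions : ∀ {n} → Permutation′ n → ℕ
inversions {n} σ =
  length (filter (λ (i , j) → (i <? j) ×-dec ((σ ⟨$⟩ʳ j) <? (σ ⟨$⟩ʳ i)))
                 (cartesianProduct (allFin n) (allFin n)))

-- For i = 0, …, r-1 the 0-based positions 2i and 2i+1, which are the 1-based
-- positions 2i-1 and 2i for i = 1, …, r.  Using ⌊ n /2⌋ in place of r avoids
-- transporting matrices along equations n ≡ 2 * r.
fst snd : ∀ {n} → Fin ⌊ n /2⌋ → Fin n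
fst {suc (suc n)} zero    = zero
fst {suc (suc n)} (suc i) = suc (suc (fst i))
snd {suc (suc n)} zero    = suc zero
snd {suc (suc n)} (suc i) = suc (suc (snd i))

InF : ∀ {n} → Permutation′ n → Set
InF {n} σ =
  (∀ (i j : Fin ⌊ n /2⌋) → i < j → (σ ⟨$⟩ʳ fst i) < (σ ⟨$⟩ʳ fst j)) ×
  (∀ (i : Fin ⌊ n /2⌋) → (σ ⟨$⟩ʳ fst i) < (σ ⟨$⟩ʳ snd i))

inF? : ∀ {n} (σ : Permutation′ n) → Dec (InF σ)
inF? σ =
  all? (λ i → all? (λ j → (i <? j) →-dec ((σ ⟨$⟩ʳ fst i) <? (σ ⟨$⟩ʳ fst j)))) ×-dec
  all? (λ i → (σ ⟨$⟩ʳ fst i) <? (σ ⟨$⟩ʳ snd i))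

-- For n = 2r, the index set of the sum defining the Pfaffian: one permutation
-- for each perfect matching of the n points.
F : ∀ n → List (Permutation′ n)
F n = filter inF? (permutations n)

subsets : ∀ l → List (Subset l)
subsets zero    = [] ∷ []
subsets (suc l) = map (outside ∷_) (subsets l) ++ map (inside ∷_) (subsets l)

subsetsOfParity : ∀ l → ℕ → List (Subset l)
subsetsOfParity l m = filter (λ K → parity ∣ K ∣ ≟ₚ parity m) (subsets l)

-- The elements of K in increasing order.
elements : ∀ {l} (K : Subset l) → Vector (Fin l) ∣ K ∣
elements (inside  ∷ K) zero    = zero
elements (inside  ∷ K) (suc i) = suc (elements K i)
elements (outside ∷ K) i       = suc (elements K i)

module Matrices {c ℓ} (R : CommutativeRing c ℓ) where

  open CommutativeRing R public
    using (Carrier; _≈_; 0#; 1#; -_; _*_)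
    renaming (_+_ to _+ᴿ_)
  open import Algebra.Definitions.RawSemiring (Semiring.rawSemiring (CommutativeRing.semiring R)) public
    using (sum; product; _^_)

  Matrix : ℕ → ℕ → Set c
  Matrix m n = Vector (Vector Carrier n) m

  record IsSkewSymmetric {n} (X : Matrix n n) : Set ℓ where
    field
      skew     : ∀ i j → X j i ≈ - X i j
      diagonal : ∀ i → X i i ≈ 0#

  infix  10 _ᵀ
  infixl 7  _·_
  infix  8  -ᴹ_

  _ᵀ : ∀ {m n} → Matrix m n → Matrix n m
  X ᵀ = Vector.transpose X

  -ᴹ_ : ∀ {m n} → Matrix m n → Matrix m n
  (-ᴹ X) i j = - X i j

  _·_ : ∀ {m k n} → Matrix m k → Matrix k n → Matrix m n
  (X · Y) i j = sum (λ k → X i k * Y k j)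

  O : ∀ {m n} → Matrix m n
  O i j = 0#

  block : ∀ {m₁ m₂ n₁ n₂} →
          Matrix m₁ n₁ → Matrix m₁ n₂ →
          Matrix m₂ n₁ → Matrix m₂ n₂ →
          Matrix (m₁ + m₂) (n₁ + n₂)
  block X Y
        Z W = Vector.zipWith Vector._++_ X Y
      Vector.++ Vector.zipWith Vector._++_ Z W

  -- The submatrix on all rows and on the columns indexed by K.
  columns : ∀ {m l} → Matrix m l → (K : Subset l) → Matrix m ∣ K ∣
  columns X K i j = X i (elements K j)

  ∑ : ∀ {a} {A : Set a} → List A → (A → Carrier) → Carrier
  ∑ xs f = foldr _+ᴿ_ 0# (map f xs)

  sgn : ∀ {n} → Permutation′ n → Carrier
  sgn σ = (- 1#) ^ inversions σ

  -- The Pfaffian when n is even; the value for odd n has no significance.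
  Pf : ∀ {n} → Matrix n n → Carrier
  Pf {n} X = ∑ (F n) (λ σ → sgn σ * product (λ i → X (σ ⟨$⟩ʳ fst i) (σ ⟨$⟩ʳ snd i)))

{-# OPTIONS --safe #-}
module Submission where

-- For a list x of row indices let |x⟩ be the vector in the exterior algebra on
-- l generators whose coefficient at K is the Pfaffian of the rows x of A
-- bordered by S(x;K).  Expansion along the first row says that adding a row to
-- the list contracts it with the other rows through A and multiplies by a
-- vector of generators (a creation operator).  The left-hand side of the
-- theorem is the pairing of two such vectors.  The adjoint of a creation
-- operator is an annihilation operator, and by the anticommutation relations
-- this acts on the second vector as a signed sum over removals of one row,
-- weighted by the entries of S ᵗT.  So the pairing satisfies the first-row
-- expansion of the Pfaffian on the right-hand side.

open import Defs
open import Algebra.Bundles using (CommutativeRing)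
import Algebra.Properties.CommutativeMonoid.Sum as CommutativeMonoidSum
import Algebra.Properties.Semiring.Sum as SemiringSum
open import Data.Bool using (if_then_else_)
open import Data.Fin using (Fin; zero; suc; toℕ; punchIn; splitAt; _<_; _<?_)
open import Data.Fin.Permutation using (Permutation′; _⟨$⟩ʳ_; _⟨$⟩ˡ_; insert; inverseʳ)
open import Data.Fin.Properties using (0≢1+n; punchIn-mono-≤; punchIn-cancel-≤)
open import Data.Fin.Subset using (Subset; inside; outside; ⊥; ∣_∣)
open import Data.List using (List; []; _∷_; _++_; map; length; filter; tabulate; cartesianProduct; concatMap)
open import Data.List.Properties
  using (++-identityʳ; filter-++; length-++; length-map; length-tabulate; map-id; map-∘; map-tabulate; tabulate-cong)
open import Data.Nat as ℕ using (ℕ; zero; suc; parity; _≤_; s≤s; z≤n)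
open import Data.Nat.Combinatorics using (_C_; nC1≡n; nCk+nC[k+1]≡[n+1]C[k+1])
import Data.Nat.Properties as ℕ
open import Data.Parity as ℙ using (0ℙ; 1ℙ)
import Data.Parity.Properties as ℙ
open import Data.Product using (_×_; _,_; ∃)
open import Data.Sum using (_⊎_; inj₁; inj₂)
open import Data.Vec using ([]; _∷_)
open import Data.Vec.Functional as Vector using (Vector)
open import Function using (_∘_; _⇔_; mk⇔; Equivalence)
open import Level using (Level; _⊔_)
open import Relation.Binary.PropositionalEquality as ≡ using (_≡_)
open import Relation.Nullary using (Dec; yes; no; does; ¬_; contradiction)
open import Relation.Nullary.Decidable using (_×-dec_; does-⇔)

open CommutativeMonoidSum ℕ.+-0-commutativeMonoid using ()
  renaming (sum to sumℕ; sum-cong-≗ to sumℕ-cong; sum-permute to sumℕ-permute; sum-replicate-zero to sumℕ-zero)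

private variable
  α β γ : Level
  A B : Set α

-- Arithmetic of lengths and parities

suc-≡⇒≤ : ∀ {k m n} → suc k ≡ m → m ≤ n → k ≤ n
suc-≡⇒≤ ≡.refl = ℕ.<⇒≤

parity-≢ : ∀ m k → ¬ parity k ≡ parity m → parity (m ℕ.+ k) ≡ 1ℙ
parity-≢ m k neq with parity m | parity k | ℙ.+-homo-+ m k
... | 0ℙ | 0ℙ | _  = contradiction ≡.refl neq
... | 0ℙ | 1ℙ | eq = eq
... | 1ℙ | 0ℙ | eq = eq
... | 1ℙ | 1ℙ | _  = contradiction ≡.refl neq

parity-≡ : ∀ m k → parity k ≡ parity m → parity (m ℕ.+ k) ≡ 0ℙ
parity-≡ m k e = ≡.trans (ℙ.+-homo-+ m k)
  (≡.trans (≡.cong (parity m ℙ.+_) e) (ℙ.p+p≡0ℙ (parity m)))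

-- Permutations in F

indicator : {P : Set β} → Dec P → ℕ
indicator p? = if does p? then 1 else 0

indicator-⇔ : {P : Set β} {Q : Set γ} → P ⇔ Q → (p? : Dec P) (q? : Dec Q) → indicator p? ≡ indicator q?
indicator-⇔ eqv p? q? = ≡.cong (if_then 1 else 0) (does-⇔ eqv p? q?)

length-filter-tabulate : {P : A → Set β} (P? : ∀ x → Dec (P x)) → ∀ {n} (f : Fin n → A) →
  length (filter P? (tabulate f)) ≡ sumℕ (λ i → indicator (P? (f i)))
length-filter-tabulate P? {zero}  f = ≡.refl
length-filter-tabulate P? {suc n} f with P? (f zero)
... | yes _ = ≡.cong suc (length-filter-tabulate P? (f ∘ suc))
... | no  _ = length-filter-tabulate P? (f ∘ suc)

length-filter-cartesianProduct : {P : A × B → Set β} (P? : ∀ x → Dec (P x)) →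
  ∀ {m n} (f : Fin m → A) (g : Fin n → B) →
  length (filter P? (cartesianProduct (tabulate f) (tabulate g))) ≡
  sumℕ (λ i → sumℕ (λ j → indicator (P? (f i , g j))))
length-filter-cartesianProduct P? {zero}  f g = ≡.refl
length-filter-cartesianProduct P? {suc m} f g = begin
  length (filter P? (map (f zero ,_) (tabulate g) ++ rest))
    ≡⟨ ≡.cong length (filter-++ P? (map (f zero ,_) (tabulate g)) rest) ⟩
  length (filter P? (map (f zero ,_) (tabulate g)) ++ filter P? rest)
    ≡⟨ length-++ (filter P? (map (f zero ,_) (tabulate g))) ⟩
  length (filter P? (map (f zero ,_) (tabulate g))) ℕ.+ length (filter P? rest)
    ≡⟨ ≡.cong₂ (λ xs n → length (filter P? xs) ℕ.+ n)
         (map-tabulate g (f zero ,_)) (length-filter-cartesianProduct P? (f ∘ suc) g) ⟩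
  length (filter P? (tabulate (λ j → f zero , g j))) ℕ.+ _
    ≡⟨ ≡.cong (ℕ._+ _) (length-filter-tabulate P? (λ j → f zero , g j)) ⟩
  sumℕ (λ i → sumℕ (λ j → indicator (P? (f i , g j)))) ∎
  where
  open ≡.≡-Reasoning
  rest = cartesianProduct (tabulate (f ∘ suc)) (tabulate g)

inversion? : ∀ {n} (σ : Permutation′ n) i j → Dec (i < j × σ ⟨$⟩ʳ j < σ ⟨$⟩ʳ i)
inversion? σ i j = (i <? j) ×-dec ((σ ⟨$⟩ʳ j) <? (σ ⟨$⟩ʳ i))

-- A double sum can be split at its first index and reindexed by a permutation, which is awkward for
-- a filtered list of pairs.
inversions-sum : ∀ {n} (σ : Permutation′ n) →
  inversions σ ≡ sumℕ (λ i → sumℕ (λ j → indicator (inversion? σ i j)))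
inversions-sum σ = length-filter-cartesianProduct (λ (i , j) → inversion? σ i j) (λ i → i) (λ j → j)

punchIn-<-⇔ : ∀ {n} k (i j : Fin n) → (i < j) ⇔ (punchIn k i < punchIn k j)
punchIn-<-⇔ k i j = mk⇔
  (λ i<j → ℕ.≰⇒> (λ le → ℕ.<⇒≱ i<j (punchIn-cancel-≤ k j i le)))
  (λ lt → ℕ.≰⇒> (λ j≤i → ℕ.<⇒≱ lt (punchIn-mono-≤ k j i j≤i)))

-- Since `punchIn k` hits each element other than `k` once, the sum counts the elements below `k`.
#punchIn-below : ∀ {n} (k : Fin (suc n)) → sumℕ (λ i → indicator (punchIn k i <? k)) ≡ toℕ k
#punchIn-below {n}     zero    = sumℕ-zero n
#punchIn-below {suc n} (suc k) = ≡.cong suc (≡.trans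
  (sumℕ-cong (λ i → indicator-⇔ (mk⇔ ℕ.s≤s⁻¹ s≤s) (suc (punchIn k i) <? suc k) (punchIn k i <? k)))
  (#punchIn-below k))

-- Inversions that involve position `zero` correspond to the values below `k`, wherever `σ` puts
-- them. All other pairs are compared through the strictly increasing `punchIn k`, so they are
-- inversions exactly when they are inversions of `σ`.
inversions-insert : ∀ {n} (k : Fin (suc n)) (σ : Permutation′ n) →
                    inversions (insert zero k σ) ≡ toℕ k ℕ.+ inversions σ
inversions-insert k σ = begin
  inversions τ
    ≡⟨ inversions-sum τ ⟩
  -- The terms with `j = zero` have already computed to 0, since nothing is below `zero`.
  sumℕ (λ j → indicator (inversion? τ zero (suc j)))
  ℕ.+ sumℕ (λ i → sumℕ (λ j → indicator (inversion? τ (suc i) (suc j))))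
    ≡⟨ ≡.cong₂ ℕ._+_
         (sumℕ-permute (λ i → indicator (punchIn k i <? k)) σ)
         (≡.trans (inversions-sum σ) (sumℕ-cong (λ i → sumℕ-cong (λ j →
            indicator-⇔ (mk⇔ (λ (p , q) → s≤s p , to (punchIn-<-⇔ k _ _) q)
                             (λ (p , q) → ℕ.s≤s⁻¹ p , from (punchIn-<-⇔ k _ _) q))
                        (inversion? σ i j) (inversion? τ (suc i) (suc j)))))) ⟨
  sumℕ (λ i → indicator (punchIn k i <? k)) ℕ.+ inversions σ
    ≡⟨ ≡.cong (ℕ._+ inversions σ) (#punchIn-below k) ⟩
  toℕ k ℕ.+ inversions σ ∎
  where
  open ≡.≡-Reasoning
  open Equivalence
  τ = insert zero k σ

fst-or-snd : ∀ {n} → parity n ≡ 0ℙ → (p : Fin n) → ∃ (λ i → p ≡ fst i) ⊎ ∃ (λ i → p ≡ snd i)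
fst-or-snd {suc (suc n)} even zero          = inj₁ (zero , ≡.refl)
fst-or-snd {suc (suc n)} even (suc zero)    = inj₂ (zero , ≡.refl)
fst-or-snd {suc (suc n)} even (suc (suc p)) with fst-or-snd even p
... | inj₁ (i , eq) = inj₁ (suc i , ≡.cong (λ q → suc (suc q)) eq)
... | inj₂ (i , eq) = inj₂ (suc i , ≡.cong (λ q → suc (suc q)) eq)

-- Consider the position sent to `zero`. Were it the second entry of a pair, the first entry would
-- have a smaller value; were it the first entry of a later pair, position `zero` would have one.
InF⇒fixes-zero : ∀ {n} → parity n ≡ 0ℙ → (σ : Permutation′ (suc (suc n))) → InF σ → σ ⟨$⟩ʳ zero ≡ zero
InF⇒fixes-zero {n} even σ (mono , asc) with fst-or-snd {suc (suc n)} even (σ ⟨$⟩ˡ zero)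
... | inj₁ (zero  , eq) = ≡.trans (≡.cong (σ ⟨$⟩ʳ_) (≡.sym eq)) (inverseʳ σ)
... | inj₁ (suc i , eq) = contradiction
  (≡.subst (σ ⟨$⟩ʳ zero <_) (≡.trans (≡.cong (σ ⟨$⟩ʳ_) (≡.sym eq)) (inverseʳ σ)) (mono zero (suc i) (s≤s z≤n)))
  ℕ.n≮0
... | inj₂ (i , eq) = contradiction
  (≡.subst (σ ⟨$⟩ʳ fst i <_) (≡.trans (≡.cong (σ ⟨$⟩ʳ_) (≡.sym eq)) (inverseʳ σ)) (asc i))
  ℕ.n≮0

-- `zero` is fixed and paired with `suc k`, and `σ` arranges the remaining points. For even `n`,
-- `InF⇒fixes-zero` leaves only permutations of this form in the Pfaffian sum.
insert₂ : ∀ {n} → Fin (suc n) → Permutation′ n → Permutation′ (suc (suc n))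
insert₂ k σ = insert zero zero (insert zero k σ)

-- The added pair starts with the least value, so its conditions hold automatically; the others
-- transfer because `punchIn k` preserves and reflects `<`.
InF-insert₂ : ∀ {n} (k : Fin (suc n)) (σ : Permutation′ n) → InF (insert₂ k σ) ⇔ InF σ
InF-insert₂ k σ = mk⇔
  (λ (mono , asc) → (λ i j i<j → from (punchIn-<-⇔ k _ _) (ℕ.s≤s⁻¹ (mono (suc i) (suc j) (s≤s i<j))))
                  , (λ i → from (punchIn-<-⇔ k _ _) (ℕ.s≤s⁻¹ (asc (suc i)))))
  (λ (mono , asc) → (λ { zero    (suc j) _         → s≤s z≤n
                       ; (suc i) (suc j) (s≤s i<j) → s≤s (to (punchIn-<-⇔ k _ _) (mono i j i<j)) })
                  , (λ { zero    → s≤s z≤n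
                       ; (suc i) → s≤s (to (punchIn-<-⇔ k _ _) (asc i)) }))
  where open Equivalence

module Pfaffians {c ℓ : Level} (R : CommutativeRing c ℓ) where
  open CommutativeRing R hiding (zero)
  open Matrices R
    using (Matrix; block; columns; _·_; _ᵀ; -ᴹ_; O; sum; product; _^_; ∑; sgn; Pf)
  open import Algebra.Properties.Ring ring using (-1*x≈-x)
  open import Algebra.Properties.Group +-group using (⁻¹-involutive)
  open import Algebra.Solver.Ring.NaturalCoefficients.Default commutativeSemiring
    using (solve; _:=_; _:+_; _:*_)
  open SemiringSum semiring using (sum-cong-≋; sum-replicate-zero; *-distribˡ-sum)
  open CommutativeMonoidSum *-commutativeMonoid using () renaming (sum-cong-≋ to product-cong)
  open import Relation.Binary.Reasoning.Setoid setoid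

  -- Negation is written as multiplication by -1 throughout, so that the
  -- semiring solver applies.
  M : Carrier
  M = - 1#

  M*M≈1 : M * M ≈ 1#
  M*M≈1 = trans (-1*x≈-x M) (⁻¹-involutive 1#)

  x+Mx≈0 : ∀ x → x + M * x ≈ 0#
  x+Mx≈0 x = trans (+-congˡ (-1*x≈-x x)) (-‿inverseʳ x)

  ε : ℕ → Carrier
  ε n = M ^ n

  ε*ε≈1 : ∀ n → ε n * ε n ≈ 1#
  ε*ε≈1 zero    = *-identityˡ 1#
  ε*ε≈1 (suc n) = begin
    M * ε n * (M * ε n)    ≈⟨ solve 2 (λ m e → m :* e :* (m :* e) := m :* m :* (e :* e)) refl M (ε n) ⟩
    M * M * (ε n * ε n)    ≈⟨ *-cong M*M≈1 (ε*ε≈1 n) ⟩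
    1# * 1#                ≈⟨ *-identityˡ 1# ⟩
    1#                     ∎

  ε-+ : ∀ m n → ε (m ℕ.+ n) ≈ ε m * ε n
  ε-+ zero    n = sym (*-identityˡ _)
  ε-+ (suc m) n = trans (*-congˡ (ε-+ m n)) (sym (*-assoc _ _ _))

  ε-C2 : ∀ n → ε (suc n C 2) ≈ ε n * ε (n C 2)
  ε-C2 n = begin
    ε (suc n C 2)          ≡⟨ ≡.cong ε (nCk+nC[k+1]≡[n+1]C[k+1] n 1) ⟨
    ε (n C 1 ℕ.+ n C 2)    ≡⟨ ≡.cong (λ k → ε (k ℕ.+ n C 2)) (nC1≡n n) ⟩
    ε (n ℕ.+ n C 2)        ≈⟨ ε-+ n (n C 2) ⟩
    ε n * ε (n C 2)        ∎

  -- Pfaffians by row expansion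

  -- alt g (x₀ ∷ x₁ ∷ …) = Σⱼ (-1)ʲ g xⱼ (the list without xⱼ)
  alt : (A → List A → Carrier) → List A → Carrier
  alt g []       = 0#
  alt g (x ∷ xs) = g x xs + M * alt (λ y ys → g y (x ∷ ys)) xs

  -- The length equation is passed to the pointwise hypothesis because inductions under `alt` run on
  -- the length of the list.
  alt-cong : {g h : A → List A → Carrier} → ∀ xs →
             (∀ y ys → suc (length ys) ≡ length xs → g y ys ≈ h y ys) →
             alt g xs ≈ alt h xs
  alt-cong []       eq = refl
  alt-cong (x ∷ xs) eq =
    +-cong (eq x xs ≡.refl)
           (*-congˡ (alt-cong xs (λ y ys e → eq y (x ∷ ys) (≡.cong suc e))))

  alt-zero : (xs : List A) → alt (λ _ _ → 0#) xs ≈ 0#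
  alt-zero []       = refl
  alt-zero (x ∷ xs) = trans (+-identityˡ _) (trans (*-congˡ (alt-zero xs)) (zeroʳ M))

  alt-+ : ∀ (g h : A → List A → Carrier) xs →
          alt (λ y ys → g y ys + h y ys) xs ≈ alt g xs + alt h xs
  alt-+ g h []       = sym (+-identityˡ 0#)
  alt-+ g h (x ∷ xs) = trans
    (+-congˡ (*-congˡ (alt-+ (λ y ys → g y (x ∷ ys)) (λ y ys → h y (x ∷ ys)) xs)))
    (solve 5 (λ m a b a′ b′ → a :+ b :+ m :* (a′ :+ b′) := (a :+ m :* a′) :+ (b :+ m :* b′))
       refl M _ _ _ _)

  alt-* : ∀ x (g : A → List A → Carrier) xs →
          alt (λ y ys → x * g y ys) xs ≈ x * alt g xs
  alt-* x g []       = sym (zeroʳ x)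
  alt-* x g (y ∷ ys) = trans
    (+-congˡ (*-congˡ (alt-* x (λ z zs → g z (y ∷ zs)) ys)))
    (solve 4 (λ m x a b → x :* a :+ m :* (x :* b) := x :* (a :+ m :* b)) refl M x _ _)

  alt-map : ∀ (f : A → B) (g : B → List B → Carrier) xs →
            alt g (map f xs) ≈ alt (λ y ys → g (f y) (map f ys)) xs
  alt-map f g []       = refl
  alt-map f g (x ∷ xs) = +-congˡ (*-congˡ (alt-map f (λ y ys → g y (f x ∷ ys)) xs))

  -- Removing an entry of `ys` first passes all of `xs`, hence the sign `ε (length xs)`.
  alt-++ : ∀ (g : A → List A → Carrier) xs ys →
           alt g (xs ++ ys) ≈ alt (λ z zs → g z (zs ++ ys)) xs
                              + ε (length xs) * alt (λ z zs → g z (xs ++ zs)) ys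
  alt-++ g []       ys = sym (trans (+-identityˡ _) (*-identityˡ _))
  alt-++ g (x ∷ xs) ys = trans
    (+-congˡ (*-congˡ (alt-++ (λ z zs → g z (x ∷ zs)) xs ys)))
    (solve 5 (λ m a b e d → a :+ m :* (b :+ e :* d) := a :+ m :* b :+ m :* e :* d) refl M _ _ _ _)

  -- Two entries can be removed in either order. The later one moves up by one place if the earlier
  -- one goes first, so exchanging the order flips the sign.
  alt-swap : ∀ (h : A → A → List A → Carrier) xs →
             alt (λ x → alt (h x)) xs ≈ M * alt (λ y → alt (λ x → h x y)) xs
  alt-swap h []       = sym (zeroʳ M)
  alt-swap h (z ∷ zs) = begin
    alt (h z) zs + M * alt (λ x xs → h x z xs + M * alt (λ y ys → h x y (z ∷ ys)) xs) zs
      ≈⟨ +-congˡ (*-congˡ (trans (alt-+ _ _ zs) (+-congˡ (alt-* M _ zs)))) ⟩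
    alt (h z) zs + M * (alt (λ x → h x z) zs + M * alt (λ x → alt (λ y ys → h x y (z ∷ ys))) zs)
      ≈⟨ +-congˡ (*-congˡ (+-congˡ (*-congˡ (alt-swap (λ x y ys → h x y (z ∷ ys)) zs)))) ⟩
    alt (h z) zs + M * (alt (λ x → h x z) zs + M * (M * D))
      -- Inserting `M * M`, which is 1, lets the two single sums, in which `z` is removed first or
      -- second, trade places.
      ≈⟨ +-congʳ (trans (*-congʳ M*M≈1) (*-identityˡ _)) ⟨
    M * M * alt (h z) zs + M * (alt (λ x → h x z) zs + M * (M * D))
      ≈⟨ solve 4 (λ m p q d → m :* m :* p :+ m :* (q :+ m :* (m :* d))
                           := m :* (q :+ m :* (p :+ m :* d))) refl M _ _ _ ⟩
    M * (alt (λ x → h x z) zs + M * (alt (h z) zs + M * D))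
      ≈⟨ *-congˡ (+-congˡ (*-congˡ (trans (alt-+ _ _ zs) (+-congˡ (alt-* M _ zs))))) ⟨
    M * (alt (λ x → h x z) zs + M * alt (λ y ys → h z y ys + M * alt (λ x xs → h x y (z ∷ xs)) ys) zs) ∎
    where D = alt (λ y → alt (λ x xs → h x y (z ∷ xs))) zs

  -- The Pfaffian of the submatrix of a on a list of indices, by expansion
  -- along the first row; the first argument only ensures termination.
  pfWithin : ℕ → (A → A → Carrier) → List A → Carrier
  pfWithin _       a []       = 1#
  pfWithin zero    a (x ∷ xs) = 0#
  pfWithin (suc n) a (x ∷ xs) = alt (λ y ys → a x y * pfWithin n a ys) xs

  pfWithin-stable : ∀ m n (a : A → A → Carrier) xs → length xs ≤ m → length xs ≤ n →
                    pfWithin m a xs ≈ pfWithin n a xs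
  pfWithin-stable m       n       a []       _         _         = refl
  pfWithin-stable (suc m) (suc n) a (x ∷ xs) (s≤s ≤m) (s≤s ≤n) =
    alt-cong xs (λ y ys e → *-congˡ
      (pfWithin-stable m n a ys (suc-≡⇒≤ e ≤m)
                                (suc-≡⇒≤ e ≤n)))

  pf : (A → A → Carrier) → List A → Carrier
  pf a xs = pfWithin (length xs) a xs

  -- The recursive calls inside `pf` carry the bound `length xs`, which exceeds `length ys` by one;
  -- `pfWithin-stable` resets it.
  pf-∷ : ∀ (a : A → A → Carrier) x xs →
         pf a (x ∷ xs) ≈ alt (λ y ys → a x y * pf a ys) xs
  pf-∷ a x xs = alt-cong xs (λ y ys e → *-congˡ
    (pfWithin-stable (length xs) (length ys) a ys (suc-≡⇒≤ e ℕ.≤-refl) ℕ.≤-refl))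

  pf-map : ∀ (f : A → B) (a : B → B → Carrier) xs →
           pf a (map f xs) ≈ pf (λ x y → a (f x) (f y)) xs
  pf-map f a xs = go (length xs) xs ℕ.≤-refl
    where
    -- The lists produced by `alt` are not structurally smaller, so the recursion is on a bound `n`
    -- for the length.
    go : ∀ n xs → length xs ≤ n → pf a (map f xs) ≈ pf (λ x y → a (f x) (f y)) xs
    go n       []       _        = refl
    go (suc n) (x ∷ xs) (s≤s ≤n) = begin
      pf a (f x ∷ map f xs)                                          ≈⟨ pf-∷ a (f x) (map f xs) ⟩
      alt (λ y ys → a (f x) y * pf a ys) (map f xs)                  ≈⟨ alt-map f _ xs ⟩
      alt (λ y ys → a (f x) (f y) * pf a (map f ys)) xs
        ≈⟨ alt-cong xs (λ y ys e → *-congˡ (go n ys (suc-≡⇒≤ e ≤n))) ⟩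
      alt (λ y ys → a (f x) (f y) * pf (λ x y → a (f x) (f y)) ys) xs ≈⟨ pf-∷ _ x xs ⟨
      pf (λ x y → a (f x) (f y)) (x ∷ xs)                             ∎

  -- Each expansion consumes two entries, so an odd list ends in a singleton, whose expansion is an
  -- empty sum.
  pf-odd : ∀ (a : A → A → Carrier) xs → parity (length xs) ≡ 1ℙ → pf a xs ≈ 0#
  pf-odd a xs = go (length xs) xs ℕ.≤-refl
    where
    go : ∀ n xs → length xs ≤ n → parity (length xs) ≡ 1ℙ → pf a xs ≈ 0#
    go (suc n) (x ∷ xs) (s≤s ≤n) odd = begin
      pf a (x ∷ xs)                       ≈⟨ pf-∷ a x xs ⟩
      alt (λ y ys → a x y * pf a ys) xs
        ≈⟨ alt-cong xs (λ y ys e → trans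
             (*-congˡ (go n ys (suc-≡⇒≤ e ≤n)
                              (≡.trans (≡.cong (parity ∘ suc) e) odd)))
             (zeroʳ _)) ⟩
      alt (λ _ _ → 0#) xs                 ≈⟨ alt-zero xs ⟩
      0#                                  ∎

  -- Each expansion contributes one factor -1, and C(k+2,2) and C(k,2) differ by the odd number
  -- 2k+1.
  pf-neg : ∀ (a : A → A → Carrier) xs →
           pf a xs ≈ ε (length xs C 2) * pf (λ x y → - a x y) xs
  pf-neg a xs = go (length xs) xs ℕ.≤-refl
    where
    go : ∀ n xs → length xs ≤ n → pf a xs ≈ ε (length xs C 2) * pf (λ x y → - a x y) xs
    go n       []       _        = sym (*-identityˡ 1#)
    go (suc n) (x ∷ xs) (s≤s ≤n) = begin
      pf a (x ∷ xs)                                        ≈⟨ pf-∷ a x xs ⟩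
      alt (λ y ys → a x y * pf a ys) xs                    ≈⟨ alt-cong xs step ⟩
      alt (λ y ys → ε (suc (length xs) C 2) * (- a x y * pf a⁻ ys)) xs
        ≈⟨ alt-* _ _ xs ⟩
      ε (suc (length xs) C 2) * alt (λ y ys → - a x y * pf a⁻ ys) xs
        ≈⟨ *-congˡ (pf-∷ a⁻ x xs) ⟨
      ε (suc (length xs) C 2) * pf a⁻ (x ∷ xs)             ∎
      where
      a⁻ : _ → _ → Carrier
      a⁻ x y = - a x y
      sign : ∀ k → ε (suc (suc k) C 2) ≈ M * ε (k C 2)
      sign k = begin
        ε (suc (suc k) C 2)             ≈⟨ trans (ε-C2 (suc k)) (*-congˡ (ε-C2 k)) ⟩
        M * ε k * (ε k * ε (k C 2))     ≈⟨ solve 3 (λ m e f → m :* e :* (e :* f) := e :* e :* (m :* f)) refl M _ _ ⟩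
        ε k * ε k * (M * ε (k C 2))     ≈⟨ trans (*-congʳ (ε*ε≈1 k)) (*-identityˡ _) ⟩
        M * ε (k C 2)                   ∎
      step : ∀ y ys → suc (length ys) ≡ length xs →
             a x y * pf a ys ≈ ε (suc (length xs) C 2) * (- a x y * pf a⁻ ys)
      step y ys e = begin
        a x y * pf a ys                                      ≈⟨ *-congˡ (go n ys (suc-≡⇒≤ e ≤n)) ⟩
        a x y * (ε (length ys C 2) * pf a⁻ ys)               ≈⟨ trans (*-congʳ M*M≈1) (*-identityˡ _) ⟨
        M * M * (a x y * (ε (length ys C 2) * pf a⁻ ys))
          ≈⟨ solve 4 (λ m p e q → m :* m :* (p :* (e :* q)) := m :* e :* (m :* p :* q)) refl M _ _ _ ⟩
        M * ε (length ys C 2) * (M * a x y * pf a⁻ ys)       ≈⟨ *-cong (sym (sign (length ys))) (*-congʳ (-1*x≈-x _)) ⟩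
        ε (suc (suc (length ys)) C 2) * (- a x y * pf a⁻ ys) ≡⟨ ≡.cong (λ k → ε (suc k C 2) * (- a x y * pf a⁻ ys)) e ⟩
        ε (suc (length xs) C 2) * (- a x y * pf a⁻ ys)       ∎

  -- Creation and annihilation operators

  -- The exterior algebra on l generators, in coordinates: the value at K is
  -- the coefficient of the product of the generators in K.
  Fock : ℕ → Set c
  Fock l = Subset l → Carrier

  private variable
    l : ℕ

  -- Vectors are functions compared pointwise, so respect for `≈` is part of linearity. The purpose
  -- is `φ-alt`, which moves operators and pairings through a row expansion.
  record Linear (φ : Fock l → Carrier) : Set (c ⊔ ℓ) where
    field
      φ-cong : ∀ {u w} → (∀ K → u K ≈ w K) → φ u ≈ φ w
      φ-+    : ∀ u w → φ (λ K → u K + w K) ≈ φ u + φ w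
      φ-*    : ∀ x u → φ (λ K → x * u K) ≈ x * φ u

    φ-0 : φ (λ _ → 0#) ≈ 0#
    φ-0 = trans (φ-cong (λ _ → sym (zeroˡ 0#))) (trans (φ-* 0# (λ _ → 0#)) (zeroˡ _))

    φ-alt : ∀ (g : A → List A → Fock l) xs →
            φ (λ K → alt (λ y ys → g y ys K) xs) ≈ alt (λ y ys → φ (g y ys)) xs
    φ-alt g []       = φ-0
    φ-alt g (x ∷ xs) = trans (φ-+ _ _) (+-congˡ
      (trans (φ-* M _) (*-congˡ (φ-alt (λ y ys → g y (x ∷ ys)) xs))))

  open Linear

  -- Left exterior multiplication by the vector with coordinates `s`. The factor `M` arises from
  -- moving a later generator past the first one.
  create : Vector Carrier l → Fock l → Fock l
  create s u []            = 0#
  create s u (outside ∷ K) = create (s ∘ suc) (u ∘ (outside ∷_)) K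
  create s u (inside  ∷ K) = s zero * u (outside ∷ K) + M * create (s ∘ suc) (u ∘ (inside ∷_)) K

  -- Contraction (interior product) with `s`, with the same sign for passing the first generator.
  annihilate : Vector Carrier l → Fock l → Fock l
  annihilate s u []            = 0#
  annihilate s u (outside ∷ K) = s zero * u (inside ∷ K) + annihilate (s ∘ suc) (u ∘ (outside ∷_)) K
  annihilate s u (inside  ∷ K) = M * annihilate (s ∘ suc) (u ∘ (inside ∷_)) K

  create-linear : ∀ (s : Vector Carrier l) K → Linear (λ u → create s u K)
  create-linear s [] = record
    { φ-cong = λ _ → refl
    ; φ-+    = λ _ _ → sym (+-identityˡ 0#)
    ; φ-*    = λ x _ → sym (zeroʳ x)
    }
  create-linear s (outside ∷ K) = record
    { φ-cong = λ eq → φ-cong (create-linear (s ∘ suc) K) (λ K → eq (outside ∷ K))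
    ; φ-+    = λ u w → φ-+ (create-linear (s ∘ suc) K) _ _
    ; φ-*    = λ x u → φ-* (create-linear (s ∘ suc) K) x _
    }
  create-linear s (inside ∷ K) = record
    { φ-cong = λ eq → +-cong (*-congˡ (eq (outside ∷ K)))
        (*-congˡ (φ-cong (create-linear (s ∘ suc) K) (λ K → eq (inside ∷ K))))
    ; φ-+    = λ u w → trans
        (+-congˡ (*-congˡ (φ-+ (create-linear (s ∘ suc) K) _ _)))
        (solve 6 (λ s m u w a b → s :* (u :+ w) :+ m :* (a :+ b) := s :* u :+ m :* a :+ (s :* w :+ m :* b))
           refl (s zero) M _ _ _ _)
    ; φ-*    = λ x u → trans
        (+-congˡ (*-congˡ (φ-* (create-linear (s ∘ suc) K) x _)))
        (solve 5 (λ s m x u a → s :* (x :* u) :+ m :* (x :* a) := x :* (s :* u :+ m :* a))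
           refl (s zero) M x _ _)
    }

  annihilate-linear : ∀ (s : Vector Carrier l) K → Linear (λ u → annihilate s u K)
  annihilate-linear s [] = record
    { φ-cong = λ _ → refl
    ; φ-+    = λ _ _ → sym (+-identityˡ 0#)
    ; φ-*    = λ x _ → sym (zeroʳ x)
    }
  annihilate-linear s (outside ∷ K) = record
    { φ-cong = λ eq → +-cong (*-congˡ (eq (inside ∷ K)))
        (φ-cong (annihilate-linear (s ∘ suc) K) (λ K → eq (outside ∷ K)))
    ; φ-+    = λ u w → trans
        (+-congˡ (φ-+ (annihilate-linear (s ∘ suc) K) _ _))
        (solve 5 (λ s u w a b → s :* (u :+ w) :+ (a :+ b) := s :* u :+ a :+ (s :* w :+ b))
           refl (s zero) _ _ _ _)
    ; φ-*    = λ x u → trans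
        (+-congˡ (φ-* (annihilate-linear (s ∘ suc) K) x _))
        (solve 4 (λ s x u a → s :* (x :* u) :+ x :* a := x :* (s :* u :+ a))
           refl (s zero) x _ _)
    }
  annihilate-linear s (inside ∷ K) = record
    { φ-cong = λ eq → *-congˡ (φ-cong (annihilate-linear (s ∘ suc) K) (λ K → eq (inside ∷ K)))
    ; φ-+    = λ u w → trans (*-congˡ (φ-+ (annihilate-linear (s ∘ suc) K) _ _)) (distribˡ _ _ _)
    ; φ-*    = λ x u → trans (*-congˡ (φ-* (annihilate-linear (s ∘ suc) K) x _))
        (solve 3 (λ m x a → m :* (x :* a) := x :* (m :* a)) refl M x _)
    }

  dot : Vector Carrier l → Vector Carrier l → Carrier
  dot r t = sum (λ k → r k * t k)

  -- The canonical anticommutation relation. After the first generator is split off, the mixed terms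
  -- occur once with each sign and cancel; what remains is the `r₀ * t₀` term and the relation for
  -- the other generators.
  anticommutator : ∀ (r t : Vector Carrier l) u K →
    annihilate r (create t u) K + create t (annihilate r u) K ≈ dot r t * u K
  anticommutator r t u [] = trans (+-identityˡ 0#) (sym (zeroˡ _))
  anticommutator r t u (outside ∷ K) = begin
    r₀ * (t₀ * u₀ + M * E) + annihilate r′ (create t′ u⁰) K
      + create t′ (λ K → r₀ * u (inside ∷ K) + annihilate r′ u⁰ K) K
      ≈⟨ +-congˡ (trans (φ-+ (create-linear t′ K) _ _) (+-congʳ (φ-* (create-linear t′ K) r₀ _))) ⟩
    r₀ * (t₀ * u₀ + M * E) + annihilate r′ (create t′ u⁰) K
      + (r₀ * E + create t′ (annihilate r′ u⁰) K)
      ≈⟨ solve 7 (λ r t u m c p q → r :* (t :* u :+ m :* c) :+ p :+ (r :* c :+ q)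
                    := r :* (c :+ m :* c) :+ (r :* t :* u :+ (p :+ q))) refl r₀ t₀ u₀ M E _ _ ⟩
    r₀ * (E + M * E) + (r₀ * t₀ * u₀ + (annihilate r′ (create t′ u⁰) K + create t′ (annihilate r′ u⁰) K))
      ≈⟨ +-cong (trans (*-congˡ (x+Mx≈0 E)) (zeroʳ r₀)) (+-congˡ (anticommutator r′ t′ u⁰ K)) ⟩
    0# + (r₀ * t₀ * u₀ + dot r′ t′ * u₀)
      ≈⟨ trans (+-identityˡ _) (sym (distribʳ _ _ _)) ⟩
    dot r t * u₀ ∎
    where
    r₀ = r zero
    t₀ = t zero
    r′ = r ∘ suc
    t′ = t ∘ suc
    u₀ = u (outside ∷ K)
    u⁰ = u ∘ (outside ∷_)
    E  = create t′ (u ∘ (inside ∷_)) K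
  anticommutator r t u (inside ∷ K) = begin
    M * annihilate r′ (λ K → t₀ * u (outside ∷ K) + M * create t′ u¹ K) K
      + (t₀ * (r₀ * u₁ + D) + M * create t′ (λ K → M * annihilate r′ u¹ K) K)
      ≈⟨ +-cong
           (*-congˡ (trans (φ-+ (annihilate-linear r′ K) _ _)
             (+-cong (φ-* (annihilate-linear r′ K) t₀ _) (φ-* (annihilate-linear r′ K) M _))))
           (+-congˡ (*-congˡ (φ-* (create-linear t′ K) M _))) ⟩
    M * (t₀ * D + M * annihilate r′ (create t′ u¹) K)
      + (t₀ * (r₀ * u₁ + D) + M * (M * create t′ (annihilate r′ u¹) K))
      ≈⟨ solve 7 (λ r t u m d p q → m :* (t :* d :+ m :* p) :+ (t :* (r :* u :+ d) :+ m :* (m :* q))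
                    := t :* (d :+ m :* d) :+ (r :* t :* u :+ m :* m :* (p :+ q))) refl r₀ t₀ u₁ M D _ _ ⟩
    t₀ * (D + M * D) + (r₀ * t₀ * u₁ + M * M * (annihilate r′ (create t′ u¹) K + create t′ (annihilate r′ u¹) K))
      ≈⟨ +-cong (trans (*-congˡ (x+Mx≈0 D)) (zeroʳ t₀))
                (+-congˡ (trans (*-cong M*M≈1 (anticommutator r′ t′ u¹ K)) (*-identityˡ _))) ⟩
    0# + (r₀ * t₀ * u₁ + dot r′ t′ * u₁)
      ≈⟨ trans (+-identityˡ _) (sym (distribʳ _ _ _)) ⟩
    dot r t * u₁ ∎
    where
    r₀ = r zero
    t₀ = t zero
    r′ = r ∘ suc
    t′ = t ∘ suc
    u₁ = u (inside ∷ K)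
    u¹ = u ∘ (inside ∷_)
    D  = annihilate r′ (u ∘ (outside ∷_)) K

  -- The symmetric bilinear form for which the monomials in the generators are orthonormal.
  ⟨_∣_⟩ : Fock l → Fock l → Carrier
  ⟨_∣_⟩ {zero}  u w = u [] * w []
  ⟨_∣_⟩ {suc l} u w = ⟨ u ∘ (outside ∷_) ∣ w ∘ (outside ∷_) ⟩ + ⟨ u ∘ (inside ∷_) ∣ w ∘ (inside ∷_) ⟩

  pairing-cong : ∀ {u u′ w w′ : Fock l} → (∀ K → u K ≈ u′ K) → (∀ K → w K ≈ w′ K) →
                 ⟨ u ∣ w ⟩ ≈ ⟨ u′ ∣ w′ ⟩
  pairing-cong {zero}  p q = *-cong (p []) (q [])
  pairing-cong {suc l} p q =
    +-cong (pairing-cong (λ K → p (outside ∷ K)) (λ K → q (outside ∷ K)))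
           (pairing-cong (λ K → p (inside ∷ K)) (λ K → q (inside ∷ K)))

  pairing-comm : (u w : Fock l) → ⟨ u ∣ w ⟩ ≈ ⟨ w ∣ u ⟩
  pairing-comm {zero}  u w = *-comm _ _
  pairing-comm {suc l} u w =
    +-cong (pairing-comm (u ∘ (outside ∷_)) (w ∘ (outside ∷_)))
           (pairing-comm (u ∘ (inside ∷_)) (w ∘ (inside ∷_)))

  pairing-linearˡ : (w : Fock l) → Linear (λ u → ⟨ u ∣ w ⟩)
  pairing-linearˡ {zero} w = record
    { φ-cong = λ eq → *-congʳ (eq [])
    ; φ-+    = λ u v → distribʳ _ _ _
    ; φ-*    = λ x u → *-assoc _ _ _
    }
  pairing-linearˡ {suc l} w = record
    { φ-cong = λ eq → pairing-cong {w = w} eq (λ _ → refl)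
    ; φ-+    = λ u v → trans (+-cong (φ-+ ⟨-∣w⁰⟩ _ _) (φ-+ ⟨-∣w¹⟩ _ _))
        (solve 4 (λ a b c d → a :+ b :+ (c :+ d) := a :+ c :+ (b :+ d)) refl _ _ _ _)
    ; φ-*    = λ x u → trans (+-cong (φ-* ⟨-∣w⁰⟩ x _) (φ-* ⟨-∣w¹⟩ x _)) (sym (distribˡ _ _ _))
    }
    where
    ⟨-∣w⁰⟩ = pairing-linearˡ (w ∘ (outside ∷_))
    ⟨-∣w¹⟩ = pairing-linearˡ (w ∘ (inside ∷_))

  pairing-linearʳ : (u : Fock l) → Linear (λ w → ⟨ u ∣ w ⟩)
  pairing-linearʳ u = record
    { φ-cong = λ eq → pairing-cong (λ _ → refl) eq
    ; φ-+    = λ v w → trans (pairing-comm u _) (trans (φ-+ (pairing-linearˡ u) _ _)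
                         (+-cong (pairing-comm v u) (pairing-comm w u)))
    ; φ-*    = λ x w → trans (pairing-comm u _) (trans (φ-* (pairing-linearˡ u) x _)
                         (*-congˡ (pairing-comm w u)))
    }

  -- On both sides the first generator contributes `s zero` times the pairing of `u⁰` with `w¹`, and
  -- passing it costs the same factor `M`; the rest is induction on `l`.
  adjoint : ∀ s (u w : Fock l) → ⟨ create s u ∣ w ⟩ ≈ ⟨ u ∣ annihilate s w ⟩
  adjoint {zero}  s u w = trans (zeroˡ _) (sym (zeroʳ _))
  adjoint {suc l} s u w = begin
    ⟨ create s′ u⁰ ∣ w⁰ ⟩ + ⟨ (λ K → s zero * u⁰ K + M * create s′ u¹ K) ∣ w¹ ⟩
      ≈⟨ +-congˡ (trans (φ-+ (pairing-linearˡ w¹) _ _)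
                        (+-cong (φ-* (pairing-linearˡ w¹) _ _) (φ-* (pairing-linearˡ w¹) _ _))) ⟩
    ⟨ create s′ u⁰ ∣ w⁰ ⟩ + (s zero * ⟨ u⁰ ∣ w¹ ⟩ + M * ⟨ create s′ u¹ ∣ w¹ ⟩)
      ≈⟨ +-cong (adjoint s′ u⁰ w⁰) (+-congˡ (*-congˡ (adjoint s′ u¹ w¹))) ⟩
    ⟨ u⁰ ∣ annihilate s′ w⁰ ⟩ + (s zero * ⟨ u⁰ ∣ w¹ ⟩ + M * ⟨ u¹ ∣ annihilate s′ w¹ ⟩)
      ≈⟨ solve 3 (λ a b c → a :+ (b :+ c) := b :+ a :+ c) refl _ _ _ ⟩
    s zero * ⟨ u⁰ ∣ w¹ ⟩ + ⟨ u⁰ ∣ annihilate s′ w⁰ ⟩ + M * ⟨ u¹ ∣ annihilate s′ w¹ ⟩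
      ≈⟨ +-cong (trans (φ-+ (pairing-linearʳ u⁰) _ _) (+-congʳ (φ-* (pairing-linearʳ u⁰) _ _)))
                (φ-* (pairing-linearʳ u¹) _ _) ⟨
    ⟨ u⁰ ∣ (λ K → s zero * w¹ K + annihilate s′ w⁰ K) ⟩ + ⟨ u¹ ∣ (λ K → M * annihilate s′ w¹ K) ⟩ ∎
    where
    s′ = s ∘ suc
    u⁰ = u ∘ (outside ∷_)
    u¹ = u ∘ (inside ∷_)
    w⁰ = w ∘ (outside ∷_)
    w¹ = w ∘ (inside ∷_)

  -- Bordered Pfaffians as vectors, and their pairing

  toList : Subset l → List (Fin l)
  toList []            = []
  toList (outside ∷ K) = map suc (toList K)
  toList (inside  ∷ K) = zero ∷ map suc (toList K)

  -- Creating `k` at `K` reads the coefficient at `K` without `k`, with the sign given by the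
  -- position of `k` in `K`. This is how the border columns in a row expansion become an operator.
  create-toList : ∀ (s : Vector Carrier l) (f : List (Fin l) → Carrier) K →
                  create s (f ∘ toList) K ≈ alt (λ k ks → s k * f ks) (toList K)
  create-toList s f []            = refl
  create-toList s f (outside ∷ K) =
    trans (create-toList (s ∘ suc) (f ∘ map suc) K) (sym (alt-map suc _ (toList K)))
  create-toList s f (inside ∷ K)  = +-congˡ (*-congˡ
    (trans (create-toList (s ∘ suc) (f ∘ (zero ∷_) ∘ map suc) K) (sym (alt-map suc _ (toList K)))))

  -- Indexing by a disjoint union lets rows be removed from lists while each index remembers its
  -- block.
  blockForm : {A B : Set} → (A → A → Carrier) → (A → B → Carrier) →
              (B → A → Carrier) → (B → B → Carrier) → A ⊎ B → A ⊎ B → Carrier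
  blockForm a b c d (inj₁ i) (inj₁ j) = a i j
  blockForm a b c d (inj₁ i) (inj₂ k) = b i k
  blockForm a b c d (inj₂ k) (inj₁ j) = c k j
  blockForm a b c d (inj₂ k) (inj₂ h) = d k h

  vacuum : Fock l
  vacuum []            = 1#
  vacuum (outside ∷ K) = vacuum K
  vacuum (inside  ∷ K) = 0#

  -- Every term in the expansion of a nonempty list has a zero entry. The renaming `f` absorbs the
  -- `map suc` in `toList`, which keeps the induction on `K` going.
  pf-zero-form : ∀ (K : Subset l) (f : Fin l → A) → pf (λ _ _ → 0#) (map f (toList K)) ≈ vacuum K
  pf-zero-form []            f = refl
  pf-zero-form (outside ∷ K) f = trans (reflexive (≡.cong (pf (λ _ _ → 0#)) (≡.sym (map-∘ (toList K)))))
                                       (pf-zero-form K (f ∘ suc))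
  pf-zero-form (inside ∷ K)  f = begin
    pf (λ _ _ → 0#) (f zero ∷ xs)               ≈⟨ pf-∷ _ (f zero) xs ⟩
    alt (λ y ys → 0# * pf (λ _ _ → 0#) ys) xs   ≈⟨ alt-* 0# (λ _ ys → pf (λ _ _ → 0#) ys) xs ⟩
    0# * alt (λ y ys → pf (λ _ _ → 0#) ys) xs   ≈⟨ zeroˡ _ ⟩
    0#                                          ∎
    where xs = map f (map suc (toList K))

  pairing-vacuum : (w : Fock l) → ⟨ vacuum ∣ w ⟩ ≈ w ⊥
  pairing-vacuum {zero}  w = *-identityˡ (w [])
  pairing-vacuum {suc l} w =
    trans (+-cong (pairing-vacuum (w ∘ (outside ∷_))) (φ-0 (pairing-linearˡ (w ∘ (inside ∷_)))))
          (+-identityʳ _)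

  toList-⊥ : ∀ l → toList (⊥ {l}) ≡ []
  toList-⊥ zero    = ≡.refl
  toList-⊥ (suc l) = ≡.cong (map suc) (toList-⊥ l)

  bordered : {A : Set} → (A → A → Carrier) → (A → Vector Carrier l) →
             A ⊎ Fin l → A ⊎ Fin l → Carrier
  bordered a s = blockForm a s (λ k i → - s i k) (λ _ _ → 0#)

  annihilate-vacuum : ∀ (r : Vector Carrier l) K → annihilate r vacuum K ≈ 0#
  annihilate-vacuum r []            = refl
  annihilate-vacuum r (outside ∷ K) =
    trans (+-cong (zeroʳ _) (annihilate-vacuum (r ∘ suc) K)) (+-identityˡ 0#)
  annihilate-vacuum r (inside ∷ K)  =
    trans (*-congˡ (φ-0 (annihilate-linear (r ∘ suc) K))) (zeroʳ M)

  -- The vector |x⟩ of the introduction, for the row list `xs`.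
  fock : {A : Set} → (A → A → Carrier) → (A → Vector Carrier l) → List A → Fock l
  fock a s xs K = pf (bordered a s) (map inj₁ xs ++ map inj₂ (toList K))

  module _ {A : Set} (a : A → A → Carrier) (s : A → Vector Carrier l) where

    fock-[] : ∀ K → fock a s [] K ≈ vacuum K
    fock-[] K = trans (pf-map inj₂ (bordered a s) (toList K))
      (trans (reflexive (≡.cong (pf _) (≡.sym (map-id (toList K))))) (pf-zero-form K (λ k → k)))

    fock-⊥ : ∀ xs → fock a s xs ⊥ ≈ pf a xs
    fock-⊥ xs = begin
      pf (bordered a s) (map inj₁ xs ++ map inj₂ (toList (⊥ {l})))
        ≡⟨ ≡.cong (λ ks → pf (bordered a s) (map inj₁ xs ++ map inj₂ ks)) (toList-⊥ l) ⟩
      pf (bordered a s) (map inj₁ xs ++ [])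
        ≡⟨ ≡.cong (pf (bordered a s)) (++-identityʳ (map inj₁ xs)) ⟩
      pf (bordered a s) (map inj₁ xs)
        ≈⟨ pf-map inj₁ (bordered a s) xs ⟩
      pf a xs ∎

    -- In the expansion along row `x`, removing another row gives an entry of `a`, while removing a
    -- column in `K` gives the creation term, with a sign for passing all of `xs`.
    fock-∷ : ∀ x xs K → fock a s (x ∷ xs) K ≈
             alt (λ y ys → a x y * fock a s ys K) xs
             + ε (length xs) * create (s x) (fock a s xs) K
    fock-∷ x xs K = begin
      pf b (inj₁ x ∷ (map inj₁ xs ++ map inj₂ ks))
        ≈⟨ pf-∷ b (inj₁ x) (map inj₁ xs ++ map inj₂ ks) ⟩
      alt (λ y ys → b (inj₁ x) y * pf b ys) (map inj₁ xs ++ map inj₂ ks)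
        ≈⟨ alt-++ _ (map inj₁ xs) (map inj₂ ks) ⟩
      alt (λ y ys → b (inj₁ x) y * pf b (ys ++ map inj₂ ks)) (map inj₁ xs)
      + ε (length (map inj₁ xs)) * alt (λ y ys → b (inj₁ x) y * pf b (map inj₁ xs ++ ys)) (map inj₂ ks)
        ≈⟨ +-cong (alt-map inj₁ _ xs)
                  (*-cong (reflexive (≡.cong ε (length-map inj₁ xs))) (alt-map inj₂ _ ks)) ⟩
      alt (λ y ys → a x y * fock a s ys K) xs
      + ε (length xs) * alt (λ k ks → s x k * pf b (map inj₁ xs ++ map inj₂ ks)) ks
        ≈⟨ +-congˡ (*-congˡ (create-toList (s x) (λ ks → pf b (map inj₁ xs ++ map inj₂ ks)) K)) ⟨
      alt (λ y ys → a x y * fock a s ys K) xs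
      + ε (length xs) * create (s x) (fock a s xs) K ∎
      where
      b  = bordered a s
      ks = toList K

    -- The sign is -(-1)^|xs| = (-1)^(|xs|-1), written without subtraction.
    annihilate-fock : ∀ r xs K → annihilate r (fock a s xs) K ≈
                      M * ε (length xs) * alt (λ y ys → dot r (s y) * fock a s ys K) xs
    annihilate-fock r xs = go (length xs) xs ℕ.≤-refl
      where
      v = fock a s
      -- `K` is quantified inside the induction because `create` at `K` reads the hypothesis at
      -- other coordinates.
      go : ∀ n xs → length xs ≤ n → ∀ K → annihilate r (v xs) K ≈
           M * ε (length xs) * alt (λ y ys → dot r (s y) * v ys K) xs
      go n [] _ K = begin
        annihilate r (v []) K    ≈⟨ φ-cong (annihilate-linear r K) fock-[] ⟩
        annihilate r vacuum K    ≈⟨ annihilate-vacuum r K ⟩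
        0#                       ≈⟨ zeroʳ _ ⟨
        M * 1# * 0#              ∎
      go (suc n) (x ∷ xs) (s≤s ≤n) K = begin
        annihilate r (v (x ∷ xs)) K
          ≈⟨ trans (φ-cong aK (fock-∷ x xs)) (trans (φ-+ aK _ _) (+-cong (φ-alt aK _ xs) (φ-* aK e _))) ⟩
        alt (λ y ys → annihilate r (λ K → a x y * v ys K) K) xs
        + e * annihilate r (create (s x) (v xs)) K
          -- The terms with an entry of `a` follow by induction, the creation term by
          -- anticommutation.
          ≈⟨ +-cong first (*-congˡ second) ⟩
        e * (M * P) + e * (dot r (s x) * v xs K + e * Q)
          ≈⟨ solve 5 (λ m e p d q → e :* (m :* p) :+ e :* (d :+ e :* q)
                       := e :* d :+ m :* e :* p :+ e :* e :* q) refl M e P D Q ⟩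
        e * D + M * e * P + e * e * Q
          -- Factors `M * M` are inserted so that both sides agree as semiring polynomials; the
          -- solver does not know that `M * M` is 1.
          ≈⟨ +-cong (+-cong (M²-* (e * D)) (M²-* (M * e * P))) (trans (M²-* _) (M²-* _)) ⟨
        M * M * (e * D) + M * M * (M * e * P) + M * M * (M * M * (e * e * Q))
          ≈⟨ solve 5 (λ m e p d q → m :* m :* (e :* d) :+ m :* m :* (m :* e :* p) :+ m :* m :* (m :* m :* (e :* e :* q))
                       := m :* (m :* e) :* (d :+ m :* (p :+ m :* e :* q))) refl M e P D Q ⟩
        M * (M * e) * (D + M * (P + M * e * Q))
          ≈⟨ *-congˡ (+-congˡ (*-congˡ third)) ⟨
        M * (M * e) * (D + M * alt (λ y ys → dot r (s y) * v (x ∷ ys) K) xs) ∎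
        where
        aK = annihilate-linear r K
        cK = create-linear (s x) K
        e = ε (length xs)
        D = dot r (s x) * v xs K
        P = alt (λ z → alt (λ y ys → dot r (s z) * (a x y * v ys K))) xs
        Q = alt (λ y ys → dot r (s y) * create (s x) (v ys) K) xs
        M²-* : ∀ y → M * M * y ≈ y
        M²-* y = trans (*-congʳ M*M≈1) (*-identityˡ y)
        sign : ∀ ys → suc (length ys) ≡ length xs → ε (length ys) ≈ M * e
        sign ys eq = trans (sym (M²-* _)) (trans (*-assoc _ _ _) (*-congˡ (reflexive (≡.cong ε eq))))

        first : alt (λ y ys → annihilate r (λ K → a x y * v ys K) K) xs ≈ e * (M * P)
        first = begin
          alt (λ y ys → annihilate r (λ K → a x y * v ys K) K) xs
            ≈⟨ alt-cong xs (λ y ys eq → trans (φ-* aK (a x y) (v ys)) (*-congˡ (trans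
                 (go n ys (suc-≡⇒≤ eq ≤n) K)
                 (*-congʳ (reflexive (≡.cong ε eq)))))) ⟩
          alt (λ y ys → a x y * (e * alt (λ z zs → dot r (s z) * v zs K) ys)) xs
            ≈⟨ alt-cong xs (λ y ys _ → trans
                 (solve 3 (λ a e b → a :* (e :* b) := e :* (a :* b)) refl _ _ _)
                 (*-congˡ (trans (sym (alt-* _ _ ys)) (alt-cong ys (λ z zs _ →
                    solve 3 (λ a b c → a :* (b :* c) := b :* (a :* c)) refl _ _ _))))) ⟩
          alt (λ y ys → e * alt (λ z zs → dot r (s z) * (a x y * v zs K)) ys) xs
            ≈⟨ alt-* e _ xs ⟩
          e * alt (λ y → alt (λ z zs → dot r (s z) * (a x y * v zs K))) xs
            -- In `P` the row contracted with `r` is removed first, in the preceding sum second; the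
            -- exchange costs `M`.
            ≈⟨ *-congˡ (alt-swap _ xs) ⟩
          e * (M * P) ∎

        second : annihilate r (create (s x) (v xs)) K ≈ D + e * Q
        second = begin
          -- Adding `e * Q` together with its negative replaces a subtraction: by the induction
          -- hypothesis the negative is the value of `create` after `annihilate`.
          X                            ≈⟨ +-identityʳ X ⟨
          X + 0#                       ≈⟨ +-congˡ (x+Mx≈0 (e * Q)) ⟨
          X + (e * Q + M * (e * Q))    ≈⟨ solve 4 (λ m e x q → x :+ (e :* q :+ m :* (e :* q)) := x :+ m :* e :* q :+ e :* q) refl M e X Q ⟩
          X + M * e * Q + e * Q        ≈⟨ +-congʳ (+-congˡ created) ⟨
          X + create (s x) (annihilate r (v xs)) K + e * Q
            ≈⟨ +-congʳ (anticommutator r (s x) (v xs) K) ⟩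
          D + e * Q                    ∎
          where
          X = annihilate r (create (s x) (v xs)) K
          created : create (s x) (annihilate r (v xs)) K ≈ M * e * Q
          created = begin
            create (s x) (annihilate r (v xs)) K
              ≈⟨ φ-cong cK (go n xs ≤n) ⟩
            create (s x) (λ K → M * e * alt (λ y ys → dot r (s y) * v ys K) xs) K
              ≈⟨ trans (φ-* cK _ _) (*-congˡ (φ-alt cK _ xs)) ⟩
            M * e * alt (λ y ys → create (s x) (λ K → dot r (s y) * v ys K) K) xs
              ≈⟨ *-congˡ (alt-cong xs (λ y ys _ → φ-* cK _ _)) ⟩
            M * e * Q ∎

        third : alt (λ y ys → dot r (s y) * v (x ∷ ys) K) xs ≈ P + M * e * Q
        third = begin
          alt (λ y ys → dot r (s y) * v (x ∷ ys) K) xs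
            ≈⟨ alt-cong xs (λ y ys eq → trans (*-congˡ (fock-∷ x ys K)) (trans (distribˡ _ _ _)
                 (+-cong (sym (alt-* _ _ ys)) (trans (*-congˡ (*-congʳ (sign ys eq)))
                    (solve 3 (λ a b c → a :* (b :* c) := b :* (a :* c)) refl _ _ _))))) ⟩
          alt (λ y ys → alt (λ z zs → dot r (s y) * (a x z * v zs K)) ys
                        + M * e * (dot r (s y) * create (s x) (v ys) K)) xs
            ≈⟨ trans (alt-+ _ _ xs) (+-congˡ (alt-* _ _ xs)) ⟩
          P + M * e * Q ∎

  -- Induction on `xs`. For empty `xs` the vacuum picks out the Pfaffian of `b`, and `pf-neg` turns
  -- it into that of `- b` at the cost of the sign. Otherwise the creation operator of the first row
  -- passes to the other vector as an annihilation operator, which gives the terms of the expansion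
  -- with entries `dot (s i) (t j)`.
  pairing-fock : {A B : Set} (a : A → A → Carrier) (b : B → B → Carrier)
    (s : A → Vector Carrier l) (t : B → Vector Carrier l) (g : B → A → Carrier) → ∀ xs ys →
    ⟨ fock a s xs ∣ fock b t ys ⟩ ≈
    ε (length ys C 2) * pf (blockForm a (λ i j → dot (s i) (t j)) g (λ i j → - b i j))
                           (map inj₁ xs ++ map inj₂ ys)
  pairing-fock {l = l} a b s t g xs ys = go (length xs) xs ys ℕ.≤-refl
    where
    u = fock a s
    w = fock b t
    h = blockForm a (λ i j → dot (s i) (t j)) g (λ i j → - b i j)
    p = λ xs ys → pf h (map inj₁ xs ++ map inj₂ ys)
    go : ∀ n xs ys → length xs ≤ n → ⟨ u xs ∣ w ys ⟩ ≈ ε (length ys C 2) * p xs ys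
    go n [] ys _ = begin
      ⟨ u [] ∣ w ys ⟩      ≈⟨ pairing-cong (fock-[] a s) (λ _ → refl) ⟩
      ⟨ vacuum ∣ w ys ⟩    ≈⟨ pairing-vacuum (w ys) ⟩
      w ys ⊥               ≈⟨ fock-⊥ b t ys ⟩
      pf b ys              ≈⟨ pf-neg b ys ⟩
      ε (length ys C 2) * pf (λ i j → - b i j) ys
                           ≈⟨ *-congˡ (pf-map inj₂ h ys) ⟨
      ε (length ys C 2) * p [] ys ∎
    go (suc n) (x ∷ xs) ys (s≤s ≤n) = begin
      ⟨ u (x ∷ xs) ∣ w ys ⟩
        ≈⟨ pairing-cong (fock-∷ a s x xs) (λ _ → refl) ⟩
      ⟨ (λ K → alt (λ y zs → a x y * u zs K) xs + e * create (s x) (u xs) K) ∣ w ys ⟩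
        ≈⟨ trans (φ-+ ⟨-∣w⟩ _ _) (+-cong (φ-alt ⟨-∣w⟩ _ xs) (φ-* ⟨-∣w⟩ _ _)) ⟩
      alt (λ y zs → ⟨ (λ K → a x y * u zs K) ∣ w ys ⟩) xs + e * ⟨ create (s x) (u xs) ∣ w ys ⟩
        ≈⟨ +-cong first (*-congˡ second) ⟩
      E * P + e * (E * Q)
        ≈⟨ solve 4 (λ e f p q → f :* p :+ e :* (f :* q) := f :* (p :+ e :* q)) refl e E P Q ⟩
      E * (P + e * Q)
        ≈⟨ *-congˡ third ⟨
      E * p (x ∷ xs) ys ∎
      where
      ⟨-∣w⟩ = pairing-linearˡ (w ys)
      ⟨u∣-⟩ = pairing-linearʳ (u xs)
      e = ε (length xs)
      E = ε (length ys C 2)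
      P = alt (λ y zs → a x y * p zs ys) xs
      Q = alt (λ y zs → dot (s x) (t y) * p xs zs) ys

      first : alt (λ y zs → ⟨ (λ K → a x y * u zs K) ∣ w ys ⟩) xs ≈ E * P
      first = trans
        (alt-cong xs (λ y zs eq → trans (φ-* ⟨-∣w⟩ _ _) (trans
           (*-congˡ (go n zs ys (suc-≡⇒≤ eq ≤n)))
           (solve 3 (λ a b c → a :* (b :* c) := b :* (a :* c)) refl _ _ _))))
        (alt-* E _ xs)

      -- With m = k+1 the factors `M * ε m` reduce to `ε k`, and k + C(k,2) = C(m,2) restores the
      -- sign for the longer list.
      sign : ∀ k m → suc k ≡ m → M * ε m * ε (k C 2) ≈ ε (m C 2)
      sign k m ≡.refl = begin
        M * (M * ε k) * ε (k C 2)     ≈⟨ solve 3 (λ m e f → m :* (m :* e) :* f := m :* m :* (e :* f)) refl M _ _ ⟩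
        M * M * (ε k * ε (k C 2))     ≈⟨ trans (*-congʳ M*M≈1) (*-identityˡ _) ⟩
        ε k * ε (k C 2)               ≈⟨ ε-C2 k ⟨
        ε (suc k C 2)                 ∎

      second : ⟨ create (s x) (u xs) ∣ w ys ⟩ ≈ E * Q
      second = begin
        ⟨ create (s x) (u xs) ∣ w ys ⟩
          ≈⟨ adjoint (s x) (u xs) (w ys) ⟩
        ⟨ u xs ∣ annihilate (s x) (w ys) ⟩
          ≈⟨ φ-cong ⟨u∣-⟩ (annihilate-fock b t (s x) ys) ⟩
        ⟨ u xs ∣ (λ K → M * ε (length ys) * alt (λ y zs → dot (s x) (t y) * w zs K) ys) ⟩
          ≈⟨ trans (φ-* ⟨u∣-⟩ _ _) (*-congˡ (φ-alt ⟨u∣-⟩ _ ys)) ⟩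
        M * ε (length ys) * alt (λ y zs → ⟨ u xs ∣ (λ K → dot (s x) (t y) * w zs K) ⟩) ys
          ≈⟨ alt-* _ _ ys ⟨
        alt (λ y zs → M * ε (length ys) * ⟨ u xs ∣ (λ K → dot (s x) (t y) * w zs K) ⟩) ys
          ≈⟨ alt-cong ys (λ y zs eq → trans
               (*-congˡ (trans (φ-* ⟨u∣-⟩ _ _) (*-congˡ (go n xs zs ≤n))))
               (trans (solve 4 (λ m d f q → m :* (d :* (f :* q)) := m :* f :* (d :* q)) refl _ _ _ _)
                      (*-congʳ (sign (length zs) (length ys) eq)))) ⟩
        alt (λ y zs → E * (dot (s x) (t y) * p xs zs)) ys
          ≈⟨ alt-* E _ ys ⟩
        E * Q ∎

      third : p (x ∷ xs) ys ≈ P + e * Q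
      third = begin
        pf h (inj₁ x ∷ (map inj₁ xs ++ map inj₂ ys))
          ≈⟨ pf-∷ h (inj₁ x) (map inj₁ xs ++ map inj₂ ys) ⟩
        alt (λ y zs → h (inj₁ x) y * pf h zs) (map inj₁ xs ++ map inj₂ ys)
          ≈⟨ alt-++ _ (map inj₁ xs) (map inj₂ ys) ⟩
        alt (λ y zs → h (inj₁ x) y * pf h (zs ++ map inj₂ ys)) (map inj₁ xs)
        + ε (length (map inj₁ xs)) * alt (λ y zs → h (inj₁ x) y * pf h (map inj₁ xs ++ zs)) (map inj₂ ys)
          ≈⟨ +-cong (alt-map inj₁ _ xs)
                    (*-cong (reflexive (≡.cong ε (length-map inj₁ xs))) (alt-map inj₂ _ ys)) ⟩
        P + e * Q ∎

  -- The Pfaffian as a sum over F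

  -- Keeping excluded terms as zeros, instead of filtering, leaves a sum over all permutations,
  -- which splits according to the image of `zero`.
  when : ∀ {P : Set β} → Dec P → Carrier → Carrier
  when p? x = if does p? then x else 0#

  when-no : ∀ {P : Set β} {x} (p? : Dec P) → ¬ P → when p? x ≈ 0#
  when-no (yes p) ¬p = contradiction p ¬p
  when-no (no _)  _  = refl

  when-cong : ∀ {P : Set β} {Q : Set γ} {x y} → P ⇔ Q → (p? : Dec P) (q? : Dec Q) →
              x ≈ y → when p? x ≈ when q? y
  when-cong P⇔Q (yes p) (yes q) x≈y = x≈y
  when-cong P⇔Q (yes p) (no ¬q) _   = contradiction (Equivalence.to P⇔Q p) ¬q
  when-cong P⇔Q (no ¬p) (yes q) _   = contradiction (Equivalence.from P⇔Q q) ¬p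
  when-cong P⇔Q (no _)  (no _)  _   = refl

  when-* : ∀ {P : Set β} (p? : Dec P) y x → y * when p? x ≈ when p? (y * x)
  when-* (yes _) y x = refl
  when-* (no _)  y x = zeroʳ y

  ∑-cong : ∀ {f g : A → Carrier} xs → (∀ x → f x ≈ g x) → ∑ xs f ≈ ∑ xs g
  ∑-cong []       eq = refl
  ∑-cong (x ∷ xs) eq = +-cong (eq x) (∑-cong xs eq)

  ∑-zero : ∀ (xs : List A) → ∑ xs (λ _ → 0#) ≈ 0#
  ∑-zero []       = refl
  ∑-zero (x ∷ xs) = trans (+-identityˡ _) (∑-zero xs)

  ∑-* : ∀ y (f : A → Carrier) xs → ∑ xs (λ x → y * f x) ≈ y * ∑ xs f
  ∑-* y f []       = sym (zeroʳ y)
  ∑-* y f (x ∷ xs) = trans (+-congˡ (∑-* y f xs)) (sym (distribˡ _ _ _))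

  ∑-++ : ∀ (f : A → Carrier) xs ys → ∑ (xs ++ ys) f ≈ ∑ xs f + ∑ ys f
  ∑-++ f []       ys = sym (+-identityˡ _)
  ∑-++ f (x ∷ xs) ys = trans (+-congˡ (∑-++ f xs ys)) (sym (+-assoc _ _ _))

  ∑-map : ∀ (g : A → B) (f : B → Carrier) xs → ∑ (map g xs) f ≈ ∑ xs (f ∘ g)
  ∑-map g f []       = refl
  ∑-map g f (x ∷ xs) = +-congˡ (∑-map g f xs)

  ∑-filter : ∀ {P : A → Set β} (P? : ∀ x → Dec (P x)) (f : A → Carrier) xs →
             ∑ (filter P? xs) f ≈ ∑ xs (λ x → when (P? x) (f x))
  ∑-filter P? f []       = refl
  ∑-filter P? f (x ∷ xs) with P? x
  ... | yes _ = +-congˡ (∑-filter P? f xs)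
  ... | no  _ = trans (∑-filter P? f xs) (sym (+-identityˡ _))

  ∑-concatMap-tabulate : ∀ {n} (h : Fin n → A) (g : A → List B) (f : B → Carrier) →
    ∑ (concatMap g (tabulate h)) f ≈ sum (λ i → ∑ (g (h i)) f)
  ∑-concatMap-tabulate {n = zero}  h g f = refl
  ∑-concatMap-tabulate {n = suc n} h g f =
    trans (∑-++ f (g (h zero)) _) (+-congˡ (∑-concatMap-tabulate (h ∘ suc) g f))

  ∑-permutations : ∀ n (f : Permutation′ (suc n) → Carrier) →
    ∑ (permutations (suc n)) f ≈ sum (λ j → ∑ (permutations n) (f ∘ insert zero j))
  ∑-permutations n f = trans
    (∑-concatMap-tabulate (λ j → j) (λ j → map (insert zero j) (permutations n)) f)
    (sum-cong-≋ (λ j → ∑-map (insert zero j) f (permutations n)))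

  PfTerm : ∀ {n} → Matrix n n → Permutation′ n → Carrier
  PfTerm X σ = sgn σ * product (λ i → X (σ ⟨$⟩ʳ fst i) (σ ⟨$⟩ʳ snd i))

  Pf-cong : ∀ {n} {X Y : Matrix n n} → (∀ i j → X i j ≈ Y i j) → Pf X ≈ Pf Y
  Pf-cong {n} eq = ∑-cong (F n) (λ σ → *-congˡ {x = sgn σ}
    (product-cong (λ i → eq (σ ⟨$⟩ʳ fst i) (σ ⟨$⟩ʳ snd i))))

  -- Terms in which `zero` is not fixed vanish. The others are indexed by the partner `suc j` of
  -- `zero` and a permutation of the remaining points, and inserting the pair adds `toℕ j`
  -- inversions.
  Pf-∷ : ∀ {n} → parity n ≡ 0ℙ → (X : Matrix (suc (suc n)) (suc (suc n))) →
    Pf X ≈ sum (λ j → ε (toℕ j) * (X zero (suc j) * Pf (λ p q → X (suc (punchIn j p)) (suc (punchIn j q)))))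
  Pf-∷ {n} even X = begin
    Pf X
      ≈⟨ ∑-filter inF? (PfTerm X) (permutations (suc (suc n))) ⟩
    ∑ (permutations (suc (suc n))) term
      ≈⟨ ∑-permutations (suc n) term ⟩
    ∑ (permutations (suc n)) (term ∘ insert zero zero)
    + sum (λ j → ∑ (permutations (suc n)) (term ∘ insert zero (suc j)))
      ≈⟨ +-congˡ (trans (sum-cong-≋ (λ j → trans (∑-cong (permutations (suc n)) (vanishing j))
                                                 (∑-zero (permutations (suc n)))))
                        (sum-replicate-zero (suc n))) ⟩
    ∑ (permutations (suc n)) (term ∘ insert zero zero) + 0#
      ≈⟨ trans (+-identityʳ _) (∑-permutations n (term ∘ insert zero zero)) ⟩
    sum (λ j → ∑ (permutations n) (term ∘ insert₂ j))
      ≈⟨ sum-cong-≋ (λ j → trans (∑-cong (permutations n) (reduction j)) (trans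
           (trans (∑-* _ _ (permutations n)) (*-congˡ (∑-* _ _ (permutations n))))
           (*-congˡ (*-congˡ (sym (∑-filter inF? (PfTerm (minor j)) (permutations n))))))) ⟩
    sum (λ j → ε (toℕ j) * (X zero (suc j) * Pf (minor j))) ∎
    where
    term : Permutation′ (suc (suc n)) → Carrier
    term σ = when (inF? σ) (PfTerm X σ)

    minor : Fin (suc n) → Matrix n n
    minor j p q = X (suc (punchIn j p)) (suc (punchIn j q))

    vanishing : ∀ j π → term (insert zero (suc j) π) ≈ 0#
    vanishing j π = when-no (inF? σ) (λ inF → 0≢1+n (≡.sym (InF⇒fixes-zero even σ inF)))
      where σ = insert zero (suc j) π

    sgn-insert₂ : ∀ j π → sgn (insert₂ j π) ≈ ε (toℕ j) * sgn π
    sgn-insert₂ j π = trans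
      (reflexive (≡.cong ε (≡.trans (inversions-insert zero (insert zero j π)) (inversions-insert j π))))
      (ε-+ (toℕ j) (inversions π))

    PfTerm-insert₂ : ∀ j π → PfTerm X (insert₂ j π) ≈ ε (toℕ j) * (X zero (suc j) * PfTerm (minor j) π)
    PfTerm-insert₂ j π = trans (*-congʳ (sgn-insert₂ j π))
      (solve 4 (λ e s x p → e :* s :* (x :* p) := e :* (x :* (s :* p))) refl
         (ε (toℕ j)) (sgn π) (X zero (suc j)) (product (λ i → minor j (π ⟨$⟩ʳ fst i) (π ⟨$⟩ʳ snd i))))

    reduction : ∀ j π → term (insert₂ j π) ≈
                ε (toℕ j) * (X zero (suc j) * when (inF? π) (PfTerm (minor j) π))
    reduction j π = begin
      when (inF? (insert₂ j π)) (PfTerm X (insert₂ j π))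
        ≈⟨ when-cong (InF-insert₂ j π) (inF? (insert₂ j π)) (inF? π) (PfTerm-insert₂ j π) ⟩
      when (inF? π) (ε (toℕ j) * (X zero (suc j) * PfTerm (minor j) π))
        ≈⟨ trans (*-congˡ (when-* (inF? π) _ _)) (when-* (inF? π) _ _) ⟨
      ε (toℕ j) * (X zero (suc j) * when (inF? π) (PfTerm (minor j) π)) ∎

  -- `punchIn j` skips exactly the index `j`, so composing with it removes entry `j`.
  alt-tabulate : ∀ {n} (g : A → List A → Carrier) (x : Fin (suc n) → A) →
    alt g (tabulate x) ≈ sum (λ j → ε (toℕ j) * g (x j) (tabulate (x ∘ punchIn j)))
  alt-tabulate {n = zero}  g x = +-cong (sym (*-identityˡ _)) (zeroʳ M)
  alt-tabulate {n = suc n} g x = +-cong (sym (*-identityˡ _)) (begin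
    M * alt (λ y ys → g y (x zero ∷ ys)) (tabulate (x ∘ suc))
      ≈⟨ *-congˡ (alt-tabulate (λ y ys → g y (x zero ∷ ys)) (x ∘ suc)) ⟩
    M * sum (λ j → ε (toℕ j) * term j)
      ≈⟨ *-distribˡ-sum M (λ j → ε (toℕ j) * term j) ⟩
    sum (λ j → M * (ε (toℕ j) * term j))
      ≈⟨ sum-cong-≋ (λ j → *-assoc M (ε (toℕ j)) (term j)) ⟨
    sum (λ j → M * ε (toℕ j) * term j) ∎)
    where
    term : Vector Carrier (suc n)
    term j = g (x (suc j)) (x zero ∷ tabulate (x ∘ suc ∘ punchIn j))

  -- Both sides obey the same first-row expansion. Entries are read through `x`, so that minors have
  -- the same form with `x ∘ suc ∘ punchIn j`.
  Pf≈pf : ∀ n → parity n ≡ 0ℙ → (a : A → A → Carrier) (x : Fin n → A) →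
          Pf (λ i j → a (x i) (x j)) ≈ pf a (tabulate x)
  -- `F 0` contains just the identity, so both sides are 1.
  Pf≈pf zero          even a x = trans (+-identityʳ _) (*-identityˡ 1#)
  Pf≈pf (suc (suc n)) even a x = begin
    Pf (λ i j → a (x i) (x j))
      ≈⟨ Pf-∷ even (λ i j → a (x i) (x j)) ⟩
    sum (λ j → ε (toℕ j) * (a (x zero) (x (suc j)) *
                 Pf (λ p q → a (x (suc (punchIn j p))) (x (suc (punchIn j q))))))
      ≈⟨ sum-cong-≋ (λ j → *-congˡ {ε (toℕ j)} (*-congˡ {a (x zero) (x (suc j))}
           (Pf≈pf n even a (x ∘ suc ∘ punchIn j)))) ⟩
    sum (λ j → ε (toℕ j) * (a (x zero) (x (suc j)) * pf a (tabulate (x ∘ suc ∘ punchIn j))))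
      ≈⟨ alt-tabulate (λ y ys → a (x zero) y * pf a ys) (x ∘ suc) ⟨
    alt (λ y ys → a (x zero) y * pf a ys) (tabulate (x ∘ suc))
      ≈⟨ pf-∷ a (x zero) (tabulate (x ∘ suc)) ⟨
    pf a (tabulate x) ∎

  -- Block matrices and the final identity

  tabulate-++ : ∀ {m n} (u : Vector A m) (w : Vector A n) →
                tabulate (u Vector.++ w) ≡ tabulate u ++ tabulate w
  tabulate-++ {m = zero}  u w = ≡.refl
  tabulate-++ {m = suc m} u w = ≡.cong (u zero ∷_)
    (≡.trans (tabulate-cong shift) (tabulate-++ (u ∘ suc) w))
    where
    shift : ∀ i → (u Vector.++ w) (suc i) ≡ ((u ∘ suc) Vector.++ w) i
    shift i with splitAt m i
    ... | inj₁ _ = ≡.refl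
    ... | inj₂ _ = ≡.refl

  module _ {A B : Set} (a : A → A → Carrier) (b : A → B → Carrier)
           (c : B → A → Carrier) (d : B → B → Carrier)
           {m n : ℕ} (x : Vector A m) (y : Vector B n) where

    -- `block` and `Vector.++` both branch on `splitAt`, so one case split computes both sides.
    block-blockForm : let z = (inj₁ ∘ x) Vector.++ (inj₂ ∘ y) in ∀ p q →
      block (λ i j → a (x i) (x j)) (λ i j → b (x i) (y j))
            (λ i j → c (y i) (x j)) (λ i j → d (y i) (y j)) p q
      ≡ blockForm a b c d (z p) (z q)
    block-blockForm p q with splitAt m p
    block-blockForm p q | inj₁ _ with splitAt m q
    ... | inj₁ _ = ≡.refl
    ... | inj₂ _ = ≡.refl
    block-blockForm p q | inj₂ _ with splitAt m q
    ... | inj₁ _ = ≡.refl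
    ... | inj₂ _ = ≡.refl

    Pf-block : parity (m ℕ.+ n) ≡ 0ℙ →
      Pf (block (λ i j → a (x i) (x j)) (λ i j → b (x i) (y j))
                (λ i j → c (y i) (x j)) (λ i j → d (y i) (y j)))
      ≈ pf (blockForm a b c d) (map inj₁ (tabulate x) ++ map inj₂ (tabulate y))
    Pf-block even = begin
      _ ≈⟨ Pf-cong (λ p q → reflexive (block-blockForm p q)) ⟩
      _ ≈⟨ Pf≈pf (m ℕ.+ n) even (blockForm a b c d) ((inj₁ ∘ x) Vector.++ (inj₂ ∘ y)) ⟩
      _ ≡⟨ ≡.cong (pf (blockForm a b c d)) (≡.trans
             (tabulate-++ (inj₁ ∘ x) (inj₂ ∘ y))
             (≡.sym (≡.cong₂ _++_ (map-tabulate x inj₁) (map-tabulate y inj₂)))) ⟩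
      _ ∎

  tabulate-elements : ∀ {l} (K : Subset l) → tabulate (elements K) ≡ toList K
  tabulate-elements []            = ≡.refl
  tabulate-elements (outside ∷ K) =
    ≡.trans (≡.sym (map-tabulate (elements K) suc)) (≡.cong (map suc) (tabulate-elements K))
  tabulate-elements (inside  ∷ K) = ≡.cong (zero ∷_)
    (≡.trans (≡.sym (map-tabulate (elements K) suc)) (≡.cong (map suc) (tabulate-elements K)))

  ∑-subsets : ∀ {l} (u w : Fock l) → ∑ (subsets l) (λ K → u K * w K) ≈ ⟨ u ∣ w ⟩
  ∑-subsets {zero}  u w = +-identityʳ _
  ∑-subsets {suc l} u w = trans (∑-++ _ (map (outside ∷_) (subsets l)) _) (+-cong
    (trans (∑-map (outside ∷_) _ (subsets l)) (∑-subsets (u ∘ (outside ∷_)) (w ∘ (outside ∷_))))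
    (trans (∑-map (inside ∷_) _ (subsets l)) (∑-subsets (u ∘ (inside ∷_)) (w ∘ (inside ∷_)))))

  module _ {m l : ℕ} (A : Matrix m m) (S : Matrix m l) (K : Subset l) where

    Pf-bordered : parity (m ℕ.+ ∣ K ∣) ≡ 0ℙ →
      Pf (block A (columns S K) (-ᴹ (columns S K) ᵀ) O) ≈ fock A S (tabulate (λ i → i)) K
    Pf-bordered even = trans
      (Pf-block A S (λ k i → - S i k) (λ _ _ → 0#) (λ i → i) (elements K) even)
      (reflexive (≡.cong (λ ks → pf (bordered A S) (map inj₁ (tabulate (λ i → i)) ++ map inj₂ ks))
                         (tabulate-elements K)))

    -- Subsets of the wrong parity contribute nothing to the pairing, so the sum over subsets of one
    -- parity becomes a sum over all subsets.
    fock-odd : parity (m ℕ.+ ∣ K ∣) ≡ 1ℙ → fock A S (tabulate (λ i → i)) K ≈ 0#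
    fock-odd odd = pf-odd (bordered A S) xs (≡.trans (≡.cong parity len) odd)
      where
      is = tabulate {n = m} (λ i → i)
      xs = map inj₁ is ++ map inj₂ (toList K)
      len : length xs ≡ m ℕ.+ ∣ K ∣
      len = ≡.trans (length-++ (map inj₁ is)) (≡.cong₂ ℕ._+_
        (≡.trans (length-map inj₁ is) (length-tabulate (λ i → i)))
        (≡.trans (length-map inj₂ (toList K)) (≡.trans
          (≡.cong length (≡.sym (tabulate-elements K))) (length-tabulate (elements K)))))

  pfaffian-sum : (m n l : ℕ) → parity m ≡ parity n →
    (A : Matrix m m) (B : Matrix n n) (S : Matrix m l) (T : Matrix n l) →
    ∑ (subsetsOfParity l m) (λ K →
        Pf (block A (columns S K) (-ᴹ (columns S K) ᵀ) O)
      * Pf (block B (columns T K) (-ᴹ (columns T K) ᵀ) O))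
    ≈ ((- 1#) ^ (n C 2)) * Pf (block A (S · T ᵀ) (-ᴹ (T · S ᵀ)) (-ᴹ B))
  pfaffian-sum m n l m≡n A B S T = begin
    ∑ (subsetsOfParity l m) term
      ≈⟨ ∑-filter (λ K → parity ∣ K ∣ ℙ.≟ parity m) term (subsets l) ⟩
    ∑ (subsets l) (λ K → when (parity ∣ K ∣ ℙ.≟ parity m) (term K))
      ≈⟨ ∑-cong (subsets l) summand ⟩
    ∑ (subsets l) (λ K → u K * w K)
      ≈⟨ ∑-subsets u w ⟩
    ⟨ u ∣ w ⟩
      ≈⟨ pairing-fock A B S T g is js ⟩
    ε (length js C 2) * pf h (map inj₁ is ++ map inj₂ js)
      ≡⟨ ≡.cong (λ k → ε (k C 2) * pf h (map inj₁ is ++ map inj₂ js)) (length-tabulate {n = n} (λ j → j)) ⟩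
    ε (n C 2) * pf h (map inj₁ is ++ map inj₂ js)
      ≈⟨ *-congˡ (Pf-block A _ g _ (λ i → i) (λ j → j) (parity-≡ m n (≡.sym m≡n))) ⟨
    ε (n C 2) * Pf (block A (S · T ᵀ) (-ᴹ (T · S ᵀ)) (-ᴹ B)) ∎
    where
    is = tabulate {n = m} (λ i → i)
    js = tabulate {n = n} (λ j → j)
    u = fock A S is
    w = fock B T js
    -- These are the entries to which the lower left block `-ᴹ (T · S ᵀ)` unfolds.
    g = λ j i → - dot (T j) (S i)
    h = blockForm A (λ i j → dot (S i) (T j)) g (λ i j → - B i j)
    term : Subset l → Carrier
    term K = Pf (block A (columns S K) (-ᴹ (columns S K) ᵀ) O)
           * Pf (block B (columns T K) (-ᴹ (columns T K) ᵀ) O)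
    summand : ∀ K → when (parity ∣ K ∣ ℙ.≟ parity m) (term K) ≈ u K * w K
    summand K with parity ∣ K ∣ ℙ.≟ parity m
    ... | yes eq  = *-cong (Pf-bordered A S K (parity-≡ m ∣ K ∣ eq))
                           (Pf-bordered B T K (parity-≡ n ∣ K ∣ (≡.trans eq m≡n)))
    ... | no  neq = sym (trans (*-congʳ (fock-odd A S K (parity-≢ m ∣ K ∣ neq))) (zeroˡ _))

theorem1p1 : ∀ {c ℓ} (R : CommutativeRing c ℓ) → let open Matrices R in
    (m n l : ℕ) → parity m ≡ parity n →
    (A : Matrix m m) (B : Matrix n n) →
    IsSkewSymmetric A → IsSkewSymmetric B →
    (S : Matrix m l) (T : Matrix n l) →
    ∑ (subsetsOfParity l m) (λ K →
    Pf (block A                    (columns S K)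
    (-ᴹ (columns S K) ᵀ) O)
    * Pf (block B                    (columns T K)
    (-ᴹ (columns T K) ᵀ) O))
    ≈ ((- 1#) ^ (n C 2))
    * Pf (block A                (S · T ᵀ)
    (-ᴹ (T · S ᵀ))   (-ᴹ B))
theorem1p1 R m n l m≡n A B _ _ S T = Pfaffians.pfaffian-sum R m n l m≡n A B S T
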